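{- Let $t\ge2$ be an integer and $v$ a positive integer with $v\equiv\pm1\pmod{3t}$ and $v>6t+53$. Then every multiset of size $v-1$ with support $\{1,3,3t\}$ is realizable.
   Context: $K_v$ is the complete graph on vertex set $\{0,\dots,v-1\}$; the length of an edge $\{u,w\}$ is $\min(|u-w|,v-|u-w|)$. A multiset $L$ of size $v-1$ is realizable if some Hamiltonian path in $K_v$ has multiset of edge lengths equal to $L$. The support of a multiset is its set of distinct elements. (The paper phrases this as: the Buratti–Horak–Rosa Conjecture holds for $\{1,3,3t\}$ at such $v$; under these conditions the divisibility condition of that conjecture is vacuous, so this means exactly that all such multisets are realizable.) -}

module Defs where

open import Data.Nat using (ℕ; zero; suc; _+_; _*_; _∸_; _<_; _⊓_)
open import Data.List using (List; []; _∷_; length)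
open import Data.List.Relation.Unary.All using (All)
open import Data.List.Relation.Unary.Unique.Propositional using (Unique)
open import Data.List.Relation.Binary.Permutation.Propositional using (_↭_)
open import Data.List.Membership.Propositional using (_∈_)
open import Data.Product using (Σ; _×_)
open import Data.Sum using (_⊎_)
open import Relation.Binary.PropositionalEquality using (_≡_)

absDiff : ℕ → ℕ → ℕ
absDiff u w = (u ∸ w) + (w ∸ u)

edgeLength : ℕ → ℕ → ℕ → ℕ
edgeLength v u w = absDiff u w ⊓ (v ∸ absDiff u w)

IsHamiltonianPath : ℕ → List ℕ → Set
IsHamiltonianPath v p = (length p ≡ v) × All (_< v) p × Unique p

edgeLengths : ℕ → List ℕ → List ℕ
edgeLengths v []           = []
edgeLengths v (x ∷ [])     = []
edgeLengths v (x ∷ y ∷ p)  = edgeLength v x y ∷ edgeLengths v (y ∷ p)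

Realizable : ℕ → List ℕ → Set
Realizable v L = Σ (List ℕ) λ p → IsHamiltonianPath v p × (edgeLengths v p ↭ L)

HasSupport3 : List ℕ → ℕ → ℕ → ℕ → Set
HasSupport3 L a b c =
  All (λ x → (x ≡ a) ⊎ (x ≡ b) ⊎ (x ≡ c)) L × (a ∈ L) × (b ∈ L) × (c ∈ L)

{-# OPTIONS --safe #-}
-- In ℤ/v with v = 3tq ± 1, multiplication by 1, 3 and 3t carries {1, 3, 3t}, {1, t, tq} and {1, q, 3q},
-- respectively, onto {1, 3, 3t} (up to sign). So it suffices that, for one of these three sets {1, x, y},
-- the multiset is realized by a path on {0, …, v − 1} whose absolute differences are the prescribed labels.
--
-- Arranging the integers in x columns according to their residue modulo x and traversing the columns as a
-- serpentine gives a path starting at 0 with differences 1^a x^b whenever a ≥ x. Gluing such a path for x,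
-- reversed and reflected, to one for y gives 1^a x^b y^c whenever a > x + y. When t ≥ 3, the bound on v
-- forces this inequality for one of the three sets.
--
-- For t = 2 one more construction is needed: if 2q-labels are few compared to 2-labels, visit first the even
-- vertices with steps of length 2, and then the odd ones along a doubled path with differences 1^d q^a.
module Submission where

open import Defs
open import Data.Nat using (ℕ; _+_; _*_; _∸_; _≤_; _<_)
open import Data.Nat.Divisibility using (_∣_)
open import Data.List using (List; length)
open import Data.Sum using (_⊎_)
open import Relation.Binary.PropositionalEquality using (_≡_)

open import Data.Empty using (⊥; ⊥-elim)
open import Data.List using ([]; _∷_; _++_; _ʳ++_; applyUpTo; map; replicate)
open import Data.List.Membership.Propositional using (_∈_)
open import Data.List.Properties
  using (++-assoc; length-++; length-map; length-replicate; length-ʳ++; map-++; map-id; map-replicate)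
open import Data.List.Relation.Binary.Permutation.Propositional
  using (_↭_; prep; ↭-refl; ↭-reflexive; ↭-sym; ↭-trans; ↭⇒↭ₛ)
open import Data.List.Relation.Binary.Permutation.Propositional.Properties
  using (All-resp-↭; shift; shifts; ++-comm; ++↭ʳ++; ++⁺; ++⁺ˡ; map⁺; ↭-length; ∈-resp-↭)
import Data.List.Relation.Binary.Permutation.Setoid.Properties as Permutationₛ
open import Data.List.Relation.Unary.All as All using (All; []; _∷_)
import Data.List.Relation.Unary.All.Properties as All
open import Data.List.Relation.Unary.AllPairs using ([]; _∷_)
open import Data.List.Relation.Unary.Unique.Propositional using (Unique)
import Data.List.Relation.Unary.Unique.Propositional.Properties as Unique
open import Data.Nat using (zero; suc; _⊓_; ∣_-_∣; NonZero; >-nonZero; z≤n; s≤s)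
open import Data.Nat.Coprimality using (Coprime; coprime-divisor)
import Data.Nat.Coprimality as Coprimality
open import Data.Nat.Divisibility using (divides; m∣m*n; m%n≡0⇒n∣m; >⇒∤; ∣-trans; ∣1⇒≡1; ∣m+n∣m⇒∣n)
open import Data.Nat.DivMod
  using (_/_; _%_; [m+kn]%n≡m%n; [m+n]%n≡m%n; %-distribˡ-+; m%n<n; m%n≤n; m<n⇒m%n≡m; m≡m%n+[m/n]*n)
open import Data.Nat.Properties
open import Data.Nat.Tactic.RingSolver using (solve-∀)
open import Data.Product using (_×_; _,_; proj₁; ∃)
open import Data.Sum using (inj₁; inj₂)
open import Data.Unit using (tt)
open import Function using (_∘_; id)
open import Relation.Binary.PropositionalEquality
  using (_≢_; refl; sym; trans; cong; cong₂; subst; subst₂; setoid; module ≡-Reasoning)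
open import Relation.Nullary using (¬_; Dec; yes; no)
open import Relation.Nullary.Decidable using (from-yes)

-- Absolute differences and label lists

absDiff≡∣-∣ : ∀ u w → absDiff u w ≡ ∣ u - w ∣
absDiff≡∣-∣ zero    zero    = refl
absDiff≡∣-∣ zero    (suc w) = refl
absDiff≡∣-∣ (suc u) zero    = +-identityʳ (suc u)
absDiff≡∣-∣ (suc u) (suc w) = absDiff≡∣-∣ u w

absDiff-comm : ∀ u w → absDiff u w ≡ absDiff w u
absDiff-comm u w = +-comm (u ∸ w) (w ∸ u)

absDiff-+ : ∀ u d → absDiff u (u + d) ≡ d
absDiff-+ u d = trans (absDiff≡∣-∣ u (u + d)) (∣m-m+n∣≡n u d)

absDiff-suc : ∀ u → absDiff u (suc u) ≡ 1
absDiff-suc zero    = refl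
absDiff-suc (suc u) = absDiff-suc u

diffs : List ℕ → List ℕ
diffs []          = []
diffs (u ∷ [])    = []
diffs (u ∷ w ∷ p) = absDiff u w ∷ diffs (w ∷ p)

length-diffs : ∀ u p → length (diffs (u ∷ p)) ≡ length p
length-diffs u []      = refl
length-diffs u (w ∷ p) = cong suc (length-diffs w p)

labels : ℕ → ℕ → ℕ → List ℕ
labels x a b = replicate a 1 ++ replicate b x

length-labels : ∀ x a b → length (labels x a b) ≡ a + b
length-labels x a b = trans (length-++ (replicate a 1))
                            (cong₂ _+_ (length-replicate a) (length-replicate b))

-- A Hamiltonian path of the integers from 0 to `length D`: `steps` fixes the number of vertices, so
-- distinctness and the bound force all of them to occur. The prescribed end at 0 is what permits
-- extension and gluing.
record Standard (D : List ℕ) : Set where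
  field
    rest    : List ℕ
    unique  : Unique (0 ∷ rest)
    bounded : All (_≤ length D) rest
    steps   : diffs (0 ∷ rest) ↭ D

unique-map : {A B : Set} {P : A → Set} {f : A → B} →
             (∀ {u w} → P u → P w → f u ≡ f w → u ≡ w) →
             ∀ {ps} → All P ps → Unique ps → Unique (map f ps)
unique-map inj []         []           = []
unique-map inj (pu ∷ pps) (u≢ ∷ uniq) =
  All.map⁺ (All.zipWith (λ (pw , u≢w) fu≡fw → u≢w (inj pu pw fu≡fw)) (pps , u≢))
  ∷ unique-map inj pps uniq

+-*-injective : ∀ {x c d} k l → c < x → d < x → c + k * x ≡ d + l * x → c ≡ d × k ≡ l
+-*-injective {x@(suc _)} {c} {d} k l c<x d<x eq =
  c≡d , *-cancelʳ-≡ k l x (+-cancelˡ-≡ d _ _ (subst (λ z → z + k * x ≡ d + l * x) c≡d eq))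
  where
  open ≡-Reasoning
  c≡d : c ≡ d
  c≡d = begin
    c               ≡⟨ m<n⇒m%n≡m c<x ⟨
    c % x           ≡⟨ [m+kn]%n≡m%n c k x ⟨
    (c + k * x) % x ≡⟨ cong (_% x) eq ⟩
    (d + l * x) % x ≡⟨ [m+kn]%n≡m%n d l x ⟩
    d % x           ≡⟨ m<n⇒m%n≡m d<x ⟩
    d               ∎

-- Walks on the grid of residue classes modulo `x`

Cell : Set
Cell = ℕ × ℕ

module Grid (x n : ℕ) where

  -- The cell (c , k) with 1 ≤ c ≤ x stands for the vertex c − 1 + k x; the
  -- cell (0 , 0) is an auxiliary predecessor of the vertex 0.
  value : Cell → ℕ
  value (c , k) = (c ∸ 1) + k * x

  -- The step `around` connects opposite ends of consecutive rows: it joins `(k + 1) x` and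
  -- `(k + 1) x - 1`.
  data One : Cell → Cell → Set where
    right  : ∀ {c k} → One (c , k) (suc c , k)
    left   : ∀ {c k} → One (suc c , k) (c , k)
    around : ∀ {k} → One (1 , suc k) (x , k)

  data Far : Cell → Cell → Set where
    up   : ∀ {c k} → Far (c , k) (c , suc k)
    down : ∀ {c k} → Far (c , suc k) (c , k)

  data Trail : Cell → List Cell → ℕ → ℕ → Set where
    []  : ∀ {u} → Trail u [] 0 0
    one : ∀ {u w ps a b} → One u w → Trail w ps a b → Trail u (w ∷ ps) (suc a) b
    far : ∀ {u w ps a b} → Far u w → Trail w ps a b → Trail u (w ∷ ps) a (suc b)

  -- The start `u` is not among `cells`. Walks are built from their end by prepending steps, and `P`
  -- is only an upper bound for the set of visited cells: a step into `w` may be prepended once `w`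
  -- lies outside `P`. Coverage of the grid is never tracked, since it follows from the number of
  -- steps.
  record Walk (P : Cell → Set) (u : Cell) (a b : ℕ) : Set where
    constructor walk
    field
      cells  : List Cell
      trail  : Trail u cells a b
      unique : Unique cells
      inside : All P cells

  private variable
    P Q : Cell → Set
    u w : Cell
    a b c d h k lo hi : ℕ

  data Add (w : Cell) (P : Cell → Set) : Cell → Set where
    new : Add w P w
    old : ∀ {z} → P z → Add w P z

  data Column (c l h : ℕ) (P : Cell → Set) : Cell → Set where
    here  : ∀ {k} → l ≤ k → k < h → Column c l h P (c , k)
    there : ∀ {z} → P z → Column c l h P z

  record Free (lo hi : ℕ) (z : Cell) : Set where
    constructor free
    field
      lower : lo ≤ proj₁ z
      upper : proj₁ z < hi
      fit   : value z < n

  Avoids : ℕ → (Cell → Set) → Set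
  Avoids c P = ∀ {k} → ¬ P (c , k)

  weaken : (∀ {z} → P z → Q z) → Walk P u a b → Walk Q u a b
  weaken f (walk ps t uq ins) = walk ps t uq (All.map f ins)

  extend-unique : ∀ {w ps} → ¬ P w → All P ps → Unique ps → Unique (w ∷ ps)
  extend-unique {P} w∉ ins uq = All.map (λ pz w≡z → w∉ (subst P (sym w≡z) pz)) ins ∷ uq

  addOne : One u w → ¬ P w → Walk P w a b → Walk (Add w P) u (suc a) b
  addOne s w∉ (walk ps t uq ins) =
    walk (_ ∷ ps) (one s t) (extend-unique w∉ ins uq) (new ∷ All.map old ins)

  addFar : Far u w → ¬ P w → Walk P w a b → Walk (Add w P) u a (suc b)
  addFar s w∉ (walk ps t uq ins) =
    walk (_ ∷ ps) (far s t) (extend-unique w∉ ins uq) (new ∷ All.map old ins)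

  nowhere : Walk P u 0 0
  nowhere = walk [] [] [] []

  recount : a ≡ c → b ≡ d → Walk P u a b → Walk P u c d
  recount refl refl W = W

  ∉-column : d ≢ c → ¬ P (d , k) → ¬ Column c lo h P (d , k)
  ∉-column d≢c d∉ (here _ _)  = d≢c refl
  ∉-column d≢c d∉ (there pz) = d∉ pz

  -- The cell `(c , 0)` is left to the step that enters the column, so the new cells begin with row
  -- 1. As walks grow at the front, the topmost step is prepended first.
  climb : ∀ h → (∀ {k} → k ≤ h → ¬ P (c , k)) → Walk P (c , h) a b →
          Walk (Column c 1 (suc h) P) (c , 0) a (h + b)
  climb zero avoid W = weaken there W
  climb {P} {c} (suc h) avoid W =
    recount refl (+-suc h _) (weaken merge (climb h fresh (addFar up (avoid ≤-refl) W)))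
    where
    fresh : ∀ {k} → k ≤ h → ¬ Add (c , suc h) P (c , k)
    fresh k≤h new = 1+n≰n k≤h
    fresh k≤h (old pz) = avoid (m≤n⇒m≤1+n k≤h) pz
    merge : ∀ {z} → Column c 1 (suc h) (Add (c , suc h) P) z → Column c 1 (2 + h) P z
    merge (here l u)       = here l (m≤n⇒m≤1+n u)
    merge (there new)      = here (s≤s z≤n) ≤-refl
    merge (there (old pz)) = there pz

  descend : ∀ h → (∀ {k} → k < h → ¬ P (c , k)) → Walk P (c , 0) a b →
            Walk (Column c 0 h P) (c , h) a (h + b)
  descend zero avoid W = weaken there W
  descend {P} {c} (suc h) avoid W =
    weaken merge (addFar down fresh (descend h (avoid ∘ m≤n⇒m≤1+n) W))
    where
    fresh : ¬ Column c 0 h P (c , h)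
    fresh (here _ h<h) = n≮n h h<h
    fresh (there pz)   = avoid ≤-refl pz
    merge : ∀ {z} → Add (c , h) (Column c 0 h P) z → Column c 0 (suc h) P z
    merge new              = here z≤n ≤-refl
    merge (old (here l u)) = here l (m≤n⇒m≤1+n u)
    merge (old (there pz)) = there pz

  enterUp : ∀ h → One u (c , 0) → (∀ {k} → k ≤ h → ¬ P (c , k)) → Walk P (c , h) a b →
            Walk (Column c 0 (suc h) P) u (suc a) (h + b)
  enterUp {c = c} {P = P} h s avoid W = weaken merge (addOne s fresh (climb h avoid W))
    where
    fresh : ¬ Column c 1 (suc h) P (c , 0)
    fresh (here () _)
    fresh (there pz) = avoid z≤n pz
    merge : ∀ {z} → Add (c , 0) (Column c 1 (suc h) P) z → Column c 0 (suc h) P z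
    merge new              = here z≤n (s≤s z≤n)
    merge (old (here _ u)) = here z≤n u
    merge (old (there pz)) = there pz

  enterDown : ∀ h → One u (c , h) → (∀ {k} → k ≤ h → ¬ P (c , k)) → Walk P (c , 0) a b →
              Walk (Column c 0 (suc h) P) u (suc a) (h + b)
  enterDown {c = c} {P = P} h s avoid W = weaken merge (addOne s fresh (descend h (avoid ∘ <⇒≤) W))
    where
    fresh : ¬ Column c 0 h P (c , h)
    fresh (here _ h<h) = n≮n h h<h
    fresh (there pz)   = avoid ≤-refl pz
    merge : ∀ {z} → Add (c , h) (Column c 0 h P) z → Column c 0 (suc h) P z
    merge new              = here z≤n ≤-refl
    merge (old (here _ u)) = here z≤n (m≤n⇒m≤1+n u)
    merge (old (there pz)) = there pz

  fits-below : value (c , h) < n → k < suc h → value (c , k) < n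
  fits-below {c} {h} fit (s≤s k≤h) = ≤-<-trans (+-monoʳ-≤ (c ∸ 1) (*-monoˡ-≤ x k≤h)) fit

  column⊆Free : ∀ h → lo ≤ c → c < hi → value (c , h) < n → (∀ {z} → P z → Free lo hi z) →
                ∀ {z} → Column c 0 (suc h) P z → Free lo hi z
  column⊆Free {c = c} h lo≤c c<hi fit f (here _ k≤h) = free lo≤c c<hi (fits-below {c} {h} fit k≤h)
  column⊆Free h lo≤c c<hi fit f (there pz)   = f pz

  -- Of two neighbouring columns of equal height, one is traversed upwards and the other downwards;
  -- the walk is then back in row 0 and can go on to columns of another height.
  zigzag : ∀ h → One u (c , 0) → One (c , h) (d , h) → c ≢ d → Avoids c P → Avoids d P →
           Walk P (d , 0) a b →
           Walk (Column c 0 (suc h) (Column d 0 (suc h) P)) u (2 + a) (h + (h + b))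
  zigzag {d = d} {P = P} h s s′ c≢d c∉ d∉ W =
    enterUp h s (λ _ → ∉-column c≢d c∉)
      (enterDown h s′ (λ _ → d∉) W)

  -- The zigzags are attached from the last one backwards; `hi` is kept general so that `W` may
  -- still use columns further to the right.
  serpentineRight : ∀ m h → m * 2 + c < hi →
    (∀ {d} → c < d → d ≤ m * 2 + c → value (d , h) < n) →
    Walk (Free (suc (m * 2 + c)) hi) (m * 2 + c , 0) a b →
    Walk (Free (suc c) hi) (c , 0) (m * 2 + a) (m * 2 * h + b)
  serpentineRight zero h _ fit W = W
  serpentineRight {c} {hi} {a} {b} (suc m) h e<hi fit W =
    recount (count a (m * 2)) (count′ (m * 2) h b)
      (serpentineRight m h (≤-trans (n≤1+n _) (≤-trans (n≤1+n _) e<hi))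
        (λ c<d d≤ → fit c<d (m≤n⇒m≤1+n (m≤n⇒m≤1+n d≤)))
        (weaken (column⊆Free h ≤-refl (≤-trans (n≤1+n _) e<hi) (fit (s≤s c≤) (n≤1+n _))
                  (column⊆Free h (n≤1+n _) e<hi (fit (s≤s (m≤n⇒m≤1+n c≤)) ≤-refl)
                    (λ (free lo≤ lt v) → free (≤-trans (n≤1+n _) (≤-trans (n≤1+n _) lo≤)) lt v)))
          (zigzag h right right (λ eq → 1+n≢n (sym eq))
            (λ (free lt _ _) → 1+n≰n (≤-trans (n≤1+n _) lt)) (λ (free lt _ _) → 1+n≰n lt) W)))
    where
    c≤ : c ≤ m * 2 + c
    c≤ = m≤n+m c (m * 2)
    count : ∀ a e → e + (2 + a) ≡ 2 + e + a
    count = solve-∀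
    count′ : ∀ e h b → e * h + (h + (h + b)) ≡ h + (h + e * h) + b
    count′ = solve-∀

  serpentineLeft : ∀ m h → lo ≤ c → (∀ {d} → c ≤ d → d < m * 2 + c → value (d , h) < n) →
    Walk (Free lo c) (c , 0) a b →
    Walk (Free lo (m * 2 + c)) (m * 2 + c , 0) (m * 2 + a) (m * 2 * h + b)
  serpentineLeft zero h _ fit W = W
  serpentineLeft {lo} {c} {a} {b} (suc m) h lo≤c fit W =
    recount refl (count (m * 2) h b)
      (weaken (column⊆Free h (m≤n⇒m≤1+n lo≤) ≤-refl (fit (m≤n⇒m≤1+n c≤) ≤-refl)
                (column⊆Free h lo≤ (n≤1+n _) (fit c≤ (n≤1+n _))
                  (λ (free le lt v) → free le (m≤n⇒m≤1+n (m≤n⇒m≤1+n lt)) v)))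
        (zigzag h left left 1+n≢n
          (λ (free _ lt _) → 1+n≰n (≤-trans (n≤1+n _) lt)) (λ (free _ lt _) → n≮n _ lt)
          (serpentineLeft m h lo≤c (λ c≤d d< → fit c≤d (m≤n⇒m≤1+n (m≤n⇒m≤1+n d<))) W)))
    where
    c≤ : c ≤ m * 2 + c
    c≤ = m≤n+m c (m * 2)
    lo≤ : lo ≤ m * 2 + c
    lo≤ = ≤-trans lo≤c c≤
    count : ∀ e h b → h + (h + (e * h + b)) ≡ h + (h + e * h) + b
    count = solve-∀

  value-injective : Free 1 (suc x) u → Free 1 (suc x) w → value u ≡ value w → u ≡ w
  value-injective {suc c , k} {suc d , l} (free _ (s≤s c<x) _) (free _ (s≤s d<x) _) eq
    with refl , refl ← +-*-injective k l c<x d<x eq = refl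

  value-suc : ∀ c k → value (c , suc k) ≡ value (c , k) + x
  value-suc c k = trans (cong ((c ∸ 1) +_) (+-comm x (k * x))) (sym (+-assoc (c ∸ 1) (k * x) x))

  one-diff : Free 1 (suc x) u → Free 1 (suc x) w → One u w → absDiff (value u) (value w) ≡ 1
  one-diff {suc c , k} _ _ right = absDiff-suc (c + k * x)
  one-diff {w = suc c , k} _ _ left =
    trans (absDiff-comm (suc c + k * x) (c + k * x)) (absDiff-suc (c + k * x))
  one-diff {w = suc c , k} _ _ around =
    trans (absDiff-comm (suc c + k * suc c) (c + k * suc c)) (absDiff-suc (c + k * suc c))
  one-diff {w = zero , k} _ (free () _ _) left
  one-diff {w = zero , k} _ (free () _ _) around

  far-diff : Far u w → absDiff (value u) (value w) ≡ x
  far-diff {c , k} up = trans (cong (absDiff (value (c , k))) (value-suc c k)) (absDiff-+ (value (c , k)) x)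
  far-diff {w = c , k} down = trans (absDiff-comm (value (c , suc k)) _) (far-diff {c , k} up)

  trail-diffs : ∀ {ps} → Trail u ps a b → Free 1 (suc x) u → All (Free 1 (suc x)) ps →
                diffs (map value (u ∷ ps)) ↭ labels x a b
  trail-diffs [] fu [] = ↭-refl
  trail-diffs (one s t) fu (fw ∷ fps) rewrite one-diff fu fw s = prep 1 (trail-diffs t fw fps)
  trail-diffs (far {a = a} {b = b} s t) fu (fw ∷ fps) rewrite far-diff s =
    ↭-trans (prep x (trail-diffs t fw fps)) (↭-sym (shift x (replicate a 1) (replicate b x)))

  -- The first step leads from the auxiliary cell to the vertex 0 and is dropped, hence `suc a`. As
  -- `n` is the number of vertices visited, `value < n` becomes the bound that `Standard` demands.
  standard : n ≡ suc (a + b) → Walk (Free 1 (suc x)) (0 , 0) (suc a) b → Standard (labels x a b)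
  standard {a} {b} n≡ (walk (w ∷ ps) (one right t) uq ins@(fw ∷ fps)) = record
    { rest    = map value ps
    ; unique  = unique-map value-injective ins uq
    ; bounded = All.map⁺ (All.map (λ (free _ _ v) →
        ≤-pred (≤-trans v (≤-reflexive (trans n≡ (cong suc (sym (length-labels x a b))))))) fps)
    ; steps   = trail-diffs t fw fps
    }
  standard n≡ (walk _ (far up t) uq (free () _ _ ∷ _))

diffs-map : ∀ {f : ℕ → ℕ} {g : ℕ → ℕ} {P : ℕ → Set} →
            (∀ {u w} → P u → P w → absDiff (f u) (f w) ≡ g (absDiff u w)) →
            ∀ {p} → All P p → diffs (map f p) ≡ map g (diffs p)
diffs-map f-diff []              = refl
diffs-map f-diff (_ ∷ [])        = refl
diffs-map f-diff (pu ∷ pw ∷ pps) = cong₂ _∷_ (f-diff pu pw) (diffs-map f-diff (pw ∷ pps))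

-- Shifting the path up by 1 frees the vertex 0 as a new start.
lead : ∀ {D} → Standard D → Standard (1 ∷ D)
lead {D} S = record
  { rest    = map suc (0 ∷ rest)
  ; unique  = All.map⁺ (All.universal (λ _ ()) (0 ∷ rest)) ∷ Unique.map⁺ suc-injective unique
  ; bounded = s≤s z≤n ∷ All.map⁺ (All.map s≤s bounded)
  ; steps   = prep 1 (↭-trans (↭-reflexive diffs-suc) steps)
  }
  where
  open Standard S
  diffs-suc : diffs (map suc (0 ∷ rest)) ≡ diffs (0 ∷ rest)
  diffs-suc = trans (diffs-map {g = id} (λ _ _ → refl) (All.universal (λ _ → tt) (0 ∷ rest))) (map-id _)

-- Serpentines over columns of two heights

module Serpentine (x h s : ℕ) where

  -- For `s ≤ x`, columns 1 to `s` end in row `h + 1` (tall) and the others in row `h` (short).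
  open Grid x (suc h * x + s)

  fits-short : ∀ {d} → 1 ≤ d → d ≤ x → value (d , h) < suc h * x + s
  fits-short {suc d} _ d<x = ≤-trans (+-monoˡ-< (h * x) d<x) (m≤m+n _ s)

  fits-tall : ∀ {d} → 1 ≤ d → d ≤ s → value (d , suc h) < suc h * x + s
  fits-tall {suc d} _ d<s = ≤-trans (+-monoˡ-< (suc h * x) d<s) (≤-reflexive (+-comm s (suc h * x)))

  -- Tall pairs come first, then short ones; evenness of `s` lets the change of height happen in row
  -- 0.
  rightward : ∀ m l {a b} → s ≡ m * 2 → l * 2 + (m * 2 + 0) ≤ x →
    Walk (Free (suc (l * 2 + (m * 2 + 0))) (suc x)) (l * 2 + (m * 2 + 0) , 0) a b →
    Walk (Free 1 (suc x)) (0 , 0) (m * 2 + (l * 2 + a)) (m * 2 * suc h + (l * 2 * h + b))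
  rightward m l refl ≤x W =
    serpentineRight m (suc h) (s≤s (≤-trans (m≤n+m _ (l * 2)) ≤x))
      (λ 0<d d≤ → fits-tall 0<d (≤-trans d≤ (≤-reflexive (+-identityʳ _))))
      (serpentineRight l h (s≤s ≤x) (λ <d d≤ → fits-short (≤-trans (s≤s z≤n) <d) (≤-trans d≤ ≤x)) W)

  -- Column 1 is climbed to its extra cell `(h + 1) x`, whence `around` leads to the top of column
  -- `x`. The columns between are visited from right to left, short pairs before tall ones, and
  -- columns 2 to `c - 1` are left to `W`.
  leftward : ∀ m l c {a b} → x ≡ l * 2 + (m * 2 + c) → 2 ≤ c → 1 ≤ s →
    (∀ {d} → c ≤ d → d < m * 2 + c → d ≤ s) → Walk (Free 2 c) (c , 0) a b →
    Walk (Free 1 (suc x)) (0 , 0) (2 + (l * 2 + (m * 2 + a)))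
         (suc h + (h + (l * 2 * h + (m * 2 * suc h + b))))
  leftward m l c refl 2≤c 1≤s tall W =
    weaken (column⊆Free (suc h) ≤-refl (≤-trans 2≤x (n≤1+n _)) (fits-tall ≤-refl 1≤s)
             (column⊆Free h (≤-trans (n≤1+n 1) 2≤x) ≤-refl (fits-short (≤-trans (n≤1+n 1) 2≤x) ≤-refl)
               (λ (free lo hi v) → free (≤-trans (n≤1+n 1) lo) (m≤n⇒m≤1+n hi) v)))
      (enterUp (suc h) right (λ _ → ∉-column (<⇒≢ 2≤x) λ (free lo _ _) → 1+n≰n lo)
        (enterDown h around (λ _ (free _ lt _) → n≮n _ lt)
          (serpentineLeft l h 2≤mc
            (λ mc≤d d<x → fits-short (≤-trans (n≤1+n 1) (≤-trans 2≤mc mc≤d)) (<⇒≤ d<x))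
            (serpentineLeft m (suc h) 2≤c
              (λ c≤d d< → fits-tall (≤-trans (n≤1+n 1) (≤-trans 2≤c c≤d)) (tall c≤d d<)) W))))
    where
    2≤mc : 2 ≤ m * 2 + c
    2≤mc = ≤-trans 2≤c (m≤n+m c _)
    2≤x : 2 ≤ x
    2≤x = ≤-trans 2≤mc (m≤n+m _ (l * 2))

  single : ∀ {c d} → Free c (suc c) (c , h) → One (d , 0) (c , 0) → Walk (Free c (suc c)) (d , 0) 1 (h + 0)
  single (free lo hi fit) s =
    weaken (column⊆Free h lo hi fit (λ ())) (enterUp {P = λ _ → ⊥} h s (λ _ ()) nowhere)

  -- Visiting the last three columns in this way, instead of by a plain
  -- zigzag, trades one step of length x for one of length 1.
  curl : 4 ≤ s → Walk (Free 2 5) (5 , 0) 4 (suc h + (suc h + (h + 0)))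
  curl 4≤s =
    weaken last-columns
      (enterUp (suc h) left (λ _ → λ { (old (there (there ()))) })
        (addOne left (λ { (there (here _ h<h)) → n≮n _ h<h ; (there (there ())) })
          (enterDown (suc h) left (λ _ → λ { (there ()) })
            (enterUp {P = λ _ → ⊥} h right (λ _ ()) nowhere))))
    where
    last-columns : ∀ {z} →
      Column 4 0 (2 + h) (Add (3 , suc h) (Column 2 0 (2 + h) (Column 3 0 (suc h) (λ _ → ⊥)))) z → Free 2 5 z
    last-columns (here _ u) = free (s≤s (s≤s z≤n)) ≤-refl (fits-below {4} (fits-tall (s≤s z≤n) 4≤s) u)
    last-columns (there new) =
      free (s≤s (s≤s z≤n)) (s≤s (s≤s (s≤s (s≤s z≤n)))) (fits-tall (s≤s z≤n) (≤-trans (n≤1+n 3) 4≤s))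
    last-columns (there (old (here _ u))) =
      free ≤-refl (s≤s (s≤s (s≤s z≤n))) (fits-below {2} (fits-tall (s≤s z≤n) (≤-trans (m≤n+m 2 2) 4≤s)) u)
    last-columns (there (old (there (here _ u)))) =
      free (s≤s (s≤s z≤n)) (s≤s (s≤s (s≤s (s≤s z≤n))))
        (fits-below {3} (fits-tall (s≤s z≤n) (≤-trans (n≤1+n 3) 4≤s)) (m≤n⇒m≤1+n u))

-- Parity cases, and paths with labels 1 and `x`

data Halving : ℕ → Set where
  even : ∀ m → Halving (m * 2)
  odd  : ∀ m → Halving (suc (m * 2))

halve : ∀ n → Halving n
halve zero    = even 0
halve (suc n) with halve n
... | even m = odd m
... | odd m  = even (suc m)

module _ (h : ℕ) where

  -- A plain serpentine over `suc x` columns changes column `x` times; `lead` supplies the one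
  -- further step of length 1.
  rightward-even : ∀ m l x → suc x ≡ m * 2 + l * 2 →
                   Standard (labels (suc x) (suc x) (h * suc x + m * 2))
  rightward-even m l x x≡ = lead (standard size (recount ones (longs h (m * 2) (l * 2) (suc x) x≡)
    (rightward m l refl (≤-reflexive (sym x≡′))
      (subst (λ c → Walk (Free (suc c) (2 + x)) (c , 0) 0 0) x≡′ nowhere))))
    where
    open Serpentine (suc x) h (m * 2)
    open Grid (suc x) (suc h * suc x + m * 2)
    x≡′ : suc x ≡ l * 2 + (m * 2 + 0)
    x≡′ = trans x≡ (trans (+-comm (m * 2) _) (cong (l * 2 +_) (sym (+-identityʳ _))))
    ones : m * 2 + (l * 2 + 0) ≡ suc x
    ones = trans (cong (m * 2 +_) (+-identityʳ _)) (sym x≡)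
    longs : ∀ h e f x → x ≡ e + f → e * suc h + (f * h + 0) ≡ h * x + e
    longs h e f x refl = solved h e f where
      solved : ∀ h e f → e * suc h + (f * h + 0) ≡ h * (e + f) + e
      solved = solve-∀
    size : suc h * suc x + m * 2 ≡ suc (x + (h * suc x + m * 2))
    size = cong suc (+-assoc x (h * suc x) (m * 2))

  rightward-odd : ∀ m l → let x = suc (m * 2 + l * 2) in Standard (labels x x (h * x + m * 2))
  rightward-odd m l = lead (standard (cong suc (+-assoc (m * 2 + l * 2) (h * x) (m * 2)))
    (recount (ones (m * 2) (l * 2)) (longs h (m * 2) (l * 2))
      (rightward m l refl (≤-trans (n≤1+n c) (≤-reflexive (sym x≡)))
        (subst (λ y → Walk (Free (suc c) (suc y)) (c , 0) 1 (h + 0)) (sym x≡)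
          (single (free ≤-refl ≤-refl (fits-short (s≤s z≤n) (≤-reflexive (sym x≡)))) right)))))
    where
    x c : ℕ
    x = suc (m * 2 + l * 2)
    c = l * 2 + (m * 2 + 0)
    open Serpentine x h (m * 2)
    open Grid x (suc h * x + m * 2)
    x≡ : x ≡ suc c
    x≡ = cong suc (trans (+-comm (m * 2) _) (cong (l * 2 +_) (sym (+-identityʳ _))))
    ones : ∀ e f → e + (f + 1) ≡ suc (e + f)
    ones = solve-∀
    longs : ∀ h e f → e * suc h + (f * h + (h + 0)) ≡ h * suc (e + f) + e
    longs = solve-∀

  leftward-even : ∀ m l → let x = suc (m * 2) + suc (l * 2) in Standard (labels x x (h * x + suc (m * 2)))
  leftward-even m l = lead (standard (cong suc (+-assoc (m * 2 + suc (l * 2)) (h * x) (suc (m * 2))))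
    (recount (ones (m * 2) (l * 2)) (longs h (m * 2) (l * 2))
      (leftward m l 2 (width (m * 2) (l * 2)) ≤-refl (s≤s z≤n)
        (λ {d} _ d< → ≤-pred (≤-trans d< (≤-reflexive (+-comm (m * 2) 2)))) nowhere)))
    where
    x : ℕ
    x = suc (m * 2) + suc (l * 2)
    open Serpentine x h (suc (m * 2))
    open Grid x (suc h * x + suc (m * 2))
    width : ∀ e f → suc e + suc f ≡ f + (e + 2)
    width = solve-∀
    ones : ∀ e f → 2 + (f + (e + 0)) ≡ suc (e + suc f)
    ones = solve-∀
    longs : ∀ h e f → suc h + (h + (f * h + (e * suc h + 0))) ≡ h * (suc e + suc f) + suc e
    longs = solve-∀

  leftward-single : ∀ l → let x = 1 + suc l * 2 in Standard (labels x x (h * x + 1))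
  leftward-single l = lead (standard (cong suc (+-assoc (suc l * 2) (h * x) 1))
    (recount (ones (l * 2)) (longs h (l * 2))
      (leftward 0 l 3 (width (l * 2)) (s≤s (s≤s z≤n)) ≤-refl
        (λ 3≤d d<3 → ⊥-elim (1+n≰n (≤-trans d<3 3≤d)))
        (single (free ≤-refl ≤-refl (fits-short (s≤s z≤n) (s≤s (s≤s z≤n)))) left))))
    where
    x : ℕ
    x = 1 + suc l * 2
    open Serpentine x h 1
    open Grid x (suc h * x + 1)
    width : ∀ f → 3 + f ≡ f + 3
    width = solve-∀
    ones : ∀ f → 2 + (f + 1) ≡ 3 + f
    ones = solve-∀
    longs : ∀ h f → suc h + (h + (f * h + (h + 0))) ≡ h * (3 + f) + 1
    longs = solve-∀

  -- The extra step of length 1 in `curl` replaces the one from `lead`. The vertex that `lead` would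
  -- have added goes into the grid instead, which therefore has `4 + m * 2` tall columns for the
  -- remainder `3 + m * 2`.
  leftward-curl : ∀ m l → let x = suc (suc m * 2) + suc l * 2 in
                  Standard (labels x x (h * x + suc (suc m * 2)))
  leftward-curl m l = standard (size h x (m * 2))
    (recount (ones (m * 2) (l * 2)) (longs h (m * 2) (l * 2))
      (leftward m l 5 (width (m * 2) (l * 2)) (s≤s (s≤s z≤n)) (s≤s z≤n)
        (λ {d} _ d< → ≤-pred (≤-trans d< (≤-reflexive (+-comm (m * 2) 5))))
        (curl (s≤s (s≤s (s≤s (s≤s z≤n)))))))
    where
    x : ℕ
    x = suc (suc m * 2) + suc l * 2
    open Serpentine x h (4 + m * 2)
    open Grid x (suc h * x + (4 + m * 2))
    width : ∀ e f → 3 + e + (2 + f) ≡ f + (e + 5)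
    width = solve-∀
    ones : ∀ e f → 2 + (f + (e + 4)) ≡ suc (3 + e + (2 + f))
    ones = solve-∀
    longs : ∀ h e f → suc h + (h + (f * h + (e * suc h + (suc h + (suc h + (h + 0))))))
                    ≡ h * (3 + e + (2 + f)) + (3 + e)
    longs = solve-∀
    size : ∀ h x e → suc h * x + (4 + e) ≡ suc (x + (h * x + (3 + e)))
    size = solve-∀

  -- A serpentine can pass between columns of different heights only at the bottom, so the parities of
  -- s and r decide its direction; for odd s ≥ 3 and even r no plain serpentine exists, hence the curl.
  core : ∀ s r → 1 ≤ r → Standard (labels (s + r) (s + r) (h * (s + r) + s))
  core s r 1≤r with halve s | halve r
  ... | even m       | even (suc l) =
    subst (λ x → Standard (labels x x (h * x + m * 2))) (sym (+-suc (m * 2) (suc (l * 2))))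
      (rightward-even m (suc l) (m * 2 + suc (l * 2)) (sym (+-suc (m * 2) (suc (l * 2)))))
  ... | even m       | odd l        =
    subst (λ x → Standard (labels x x (h * x + m * 2))) (sym (+-suc (m * 2) (l * 2))) (rightward-odd m l)
  ... | odd m        | odd l        = leftward-even m l
  ... | odd zero     | even (suc l) = leftward-single l
  ... | odd (suc m)  | even (suc l) = leftward-curl m l
  core _ _ () | _ | even zero

replicate-+ : ∀ m n (z : ℕ) → replicate (m + n) z ≡ replicate m z ++ replicate n z
replicate-+ zero    n z = refl
replicate-+ (suc m) n z = cong (z ∷_) (replicate-+ m n z)

prepend-ones : ∀ k {D} → Standard D → Standard (replicate k 1 ++ D)
prepend-ones zero    S = S
prepend-ones (suc k) S = lead (prepend-ones k S)

-- Quotient and remainder of `b` by `x` determine the column heights of a path with exactly `x`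
-- ones; the surplus ones are prepended.
standard-labels : ∀ {x a} b → 1 ≤ x → x ≤ a → Standard (labels x a b)
standard-labels {x@(suc _)} {a} b _ x≤a = subst Standard ones≡ (prepend-ones (a ∸ x) S)
  where
  open ≡-Reasoning
  s≤x : b % x ≤ x
  s≤x = <⇒≤ (m%n<n b x)
  b≡ : b / x * x + b % x ≡ b
  b≡ = trans (+-comm (b / x * x) (b % x)) (sym (m≡m%n+[m/n]*n b x))
  S : Standard (labels x x b)
  S = subst₂ (λ y z → Standard (labels y y z)) (m+[n∸m]≡n s≤x)
        (trans (cong (λ y → b / x * y + b % x) (m+[n∸m]≡n s≤x)) b≡)
        (core (b / x) (b % x) (x ∸ b % x) (m<n⇒0<n∸m (m%n<n b x)))
  ones≡ : replicate (a ∸ x) 1 ++ labels x x b ≡ labels x a b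
  ones≡ = begin
    replicate (a ∸ x) 1 ++ replicate x 1 ++ replicate b x   ≡⟨ ++-assoc (replicate (a ∸ x) 1) _ _ ⟨
    (replicate (a ∸ x) 1 ++ replicate x 1) ++ replicate b x ≡⟨ cong (_++ replicate b x) (replicate-+ (a ∸ x) x 1) ⟨
    replicate (a ∸ x + x) 1 ++ replicate b x                ≡⟨ cong (λ n → labels x n b) (m∸n+n≡m x≤a) ⟩
    replicate a 1 ++ replicate b x                          ∎

-- Gluing two paths

record Linear (D : List ℕ) : Set where
  field
    path    : List ℕ
    size    : length path ≡ suc (length D)
    unique  : Unique path
    bounded : All (_≤ length D) path
    steps   : diffs path ↭ D

unique-resp-↭ : {p q : List ℕ} → p ↭ q → Unique p → Unique q
unique-resp-↭ p↭q = Permutationₛ.Unique-resp-↭ (setoid ℕ) (↭⇒↭ₛ p↭q)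

linear-resp-↭ : ∀ {D E} → D ↭ E → Linear D → Linear E
linear-resp-↭ D↭E X = record
  { path    = path
  ; size    = trans size (cong suc (↭-length D↭E))
  ; unique  = unique
  ; bounded = subst (λ k → All (_≤ k) path) (↭-length D↭E) bounded
  ; steps   = ↭-trans steps D↭E
  }
  where open Linear X

length-standard : ∀ {D} (S : Standard D) → length (Standard.rest S) ≡ length D
length-standard S = trans (sym (length-diffs 0 rest)) (↭-length steps)
  where open Standard S

linear : ∀ {D} → Standard D → Linear D
linear S = record
  { path    = 0 ∷ rest
  ; size    = cong suc (length-standard S)
  ; unique  = unique
  ; bounded = z≤n ∷ bounded
  ; steps   = steps
  }
  where open Standard S

absDiff-scale : ∀ k u w → absDiff (k * u) (k * w) ≡ k * absDiff u w
absDiff-scale k u w = begin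
  absDiff (k * u) (k * w) ≡⟨ absDiff≡∣-∣ (k * u) (k * w) ⟩
  ∣ k * u - k * w ∣       ≡⟨ *-distribˡ-∣-∣ k u w ⟨
  k * ∣ u - w ∣           ≡⟨ cong (k *_) (absDiff≡∣-∣ u w) ⟨
  k * absDiff u w         ∎
  where open ≡-Reasoning

absDiff-shift : ∀ k u w → absDiff (k + u) (k + w) ≡ absDiff u w
absDiff-shift zero    u w = refl
absDiff-shift (suc k) u w = absDiff-shift k u w

absDiff-reflect : ∀ {m u w} → u ≤ m → w ≤ m → absDiff (m ∸ u) (m ∸ w) ≡ absDiff u w
absDiff-reflect {m} {u} {w} u≤m w≤m = begin
  absDiff (m ∸ u) (m ∸ w)                     ≡⟨ absDiff-shift (u + w) _ _ ⟨
  absDiff (u + w + (m ∸ u)) (u + w + (m ∸ w)) ≡⟨ cong₂ absDiff left right ⟩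
  absDiff (m + w) (m + u)                     ≡⟨ absDiff-shift m w u ⟩
  absDiff w u                                 ≡⟨ absDiff-comm w u ⟩
  absDiff u w                                 ∎
  where
  open ≡-Reasoning
  left : u + w + (m ∸ u) ≡ m + w
  left = trans (cong (_+ (m ∸ u)) (+-comm u w))
           (trans (+-assoc w u _) (trans (cong (w +_) (m+[n∸m]≡n u≤m)) (+-comm w m)))
  right : u + w + (m ∸ w) ≡ m + u
  right = trans (+-assoc u w _) (trans (cong (u +_) (m+[n∸m]≡n w≤m)) (+-comm u m))

diffs-ʳ++ : ∀ u r w q → diffs ((u ∷ r) ʳ++ (w ∷ q)) ↭ diffs (u ∷ r) ++ absDiff u w ∷ diffs (w ∷ q)
diffs-ʳ++ u []      w q = ↭-refl
diffs-ʳ++ u (y ∷ r) w q rewrite absDiff-comm u y =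
  ↭-trans (diffs-ʳ++ y r u (w ∷ q)) (shift (absDiff y u) (diffs (y ∷ r)) _)

-- The path for `D` is reflected by `m ∸_` and reversed, so that it ends at `m`; the path for `E` is
-- shifted to start at `m + 1`. The link between them is the additional 1.
join : ∀ {D E} → Standard D → Standard E → Linear (1 ∷ D ++ E)
join {D} {E} S T = record
  { path    = front ʳ++ back
  ; size    = trans (length-ʳ++ front) (trans (cong₂ _+_ length-front length-back)
      (cong suc (trans (+-suc m (length E)) (cong suc (sym (length-++ D))))))
  ; unique  = unique-resp-↭ (++↭ʳ++ front back) (Unique.++⁺
      (unique-map (λ u≤m w≤m → ∸-cancelˡ-≡ u≤m w≤m) bounded-S S.unique)
      (Unique.map⁺ (λ {u} {w} → +-cancelˡ-≡ (suc m) u w) T.unique)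
      (λ (i , j) → <⇒≱ (All.lookup back-high j) (All.lookup front-low i)))
  ; bounded = All-resp-↭ (++↭ʳ++ front back) (All.++⁺
      (All.map (λ u≤m → ≤-trans u≤m (≤-trans (m≤m+n m (length E)) m+≤)) front-low)
      (All.map⁺ (All.map (λ u≤ → ≤-trans (+-monoʳ-≤ (suc m) u≤) (≤-reflexive (cong suc (sym (length-++ D)))))
                         (z≤n ∷ T.bounded))))
  ; steps   = ↭-trans (diffs-ʳ++ m (map (m ∸_) S.rest) (suc m + 0) (map (suc m +_) T.rest))
      (↭-trans (shift (absDiff m (suc m + 0)) (diffs front) (diffs back))
        (↭-trans (↭-reflexive (cong₂ _∷_ link (cong₂ _++_ diffs-front diffs-back)))
          (prep 1 (++⁺ S.steps T.steps))))
  }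
  where
  module S = Standard S
  module T = Standard T
  m : ℕ
  m = length D
  front back : List ℕ
  front = map (m ∸_) (0 ∷ S.rest)
  back  = map (suc m +_) (0 ∷ T.rest)
  length-front : length front ≡ suc m
  length-front = cong suc (trans (length-map (m ∸_) S.rest) (length-standard S))
  length-back : length back ≡ suc (length E)
  length-back = cong suc (trans (length-map (suc m +_) T.rest) (length-standard T))
  bounded-S : All (_≤ m) (0 ∷ S.rest)
  bounded-S = z≤n ∷ S.bounded
  front-low : All (_≤ m) front
  front-low = All.map⁺ (All.universal (λ u → m∸n≤m m u) (0 ∷ S.rest))
  back-high : All (m <_) back
  back-high = All.map⁺ (All.universal (λ u → m≤m+n (suc m) u) (0 ∷ T.rest))
  m+≤ : m + length E ≤ length (1 ∷ D ++ E)
  m+≤ = ≤-trans (≤-reflexive (sym (length-++ D))) (n≤1+n _)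
  link : absDiff m (suc m + 0) ≡ 1
  link = trans (cong (absDiff m) (+-identityʳ (suc m))) (absDiff-suc m)
  diffs-front : diffs front ≡ diffs (0 ∷ S.rest)
  diffs-front = trans (diffs-map {g = id} absDiff-reflect bounded-S) (map-id _)
  diffs-back : diffs back ≡ diffs (0 ∷ T.rest)
  diffs-back = trans
    (diffs-map {g = id} (λ {u} {w} _ _ → absDiff-shift (suc m) u w) (All.universal (λ _ → tt) (0 ∷ T.rest))) (map-id _)

-- Even vertices followed by odd ones

diffs-applyUpTo : ∀ (f : ℕ → ℕ) k n w q → (∀ i → absDiff (f i) (f (suc i)) ≡ k) →
                  diffs (applyUpTo f (suc n) ++ w ∷ q) ≡ replicate n k ++ absDiff (f n) w ∷ diffs (w ∷ q)
diffs-applyUpTo f k zero    w q f-diff = refl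
diffs-applyUpTo f k (suc n) w q f-diff =
  cong₂ _∷_ (f-diff 0) (diffs-applyUpTo (f ∘ suc) k n w q (f-diff ∘ suc))

-- The even numbers are visited upwards to `2 (m + e)`; the odd ones follow the given path,
-- reflected and doubled, from `2 m + 1` on. For `e = 0` and `e = 1` alike the two ends differ by 1,
-- so `e` adjusts the parity of the number of vertices.
rails : ∀ {D} e → e ≤ 1 → Standard D → Standard (1 ∷ replicate (length D + e) 2 ++ map (2 *_) D)
rails {D} e e≤1 S = record
  { rest    = applyUpTo (λ i → 2 * suc i) (m + e) ++ odds
  ; unique  = Unique.++⁺
      (Unique.applyUpTo⁺₁ (2 *_) (suc (m + e)) λ {i} {j} i<j _ 2i≡2j → <⇒≢ i<j (*-cancelˡ-≡ i j 2 2i≡2j))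
      (unique-map (λ u≤m w≤m eq → ∸-cancelˡ-≡ u≤m w≤m (*-cancelˡ-≡ _ _ 2 (suc-injective eq)))
        bounded-S unique)
      (λ (i , j) → disjoint (All.lookup evens-even i) (All.lookup odds-odd j))
  ; bounded = All.++⁺
      (All.applyUpTo⁺₁ _ (m + e) (λ i< → ≤-trans (*-monoʳ-≤ 2 i<) (≤-trans low (≤-reflexive size))))
      (All.map⁺ (All.universal
        (λ u → ≤-trans (s≤s (*-monoʳ-≤ 2 (m∸n≤m m u))) (≤-trans high (≤-reflexive size))) (0 ∷ rest)))
  ; steps   = ↭-trans (↭-reflexive (diffs-applyUpTo (2 *_) 2 (m + e) (odd′ 0) (map odd′ rest)
                        (λ i → trans (absDiff-scale 2 i (suc i)) (cong (2 *_) (absDiff-suc i)))))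
      (↭-trans (shift _ (replicate (m + e) 2) (diffs odds))
        (↭-trans (↭-reflexive (cong₂ (λ l E → l ∷ replicate (m + e) 2 ++ E) (link e≤1) diffs-odds))
          (prep 1 (++⁺ˡ (replicate (m + e) 2) (map⁺ (2 *_) steps)))))
  }
  where
  open Standard S
  m : ℕ
  m = length D
  odd′ : ℕ → ℕ
  odd′ z = suc (2 * (m ∸ z))
  odds : List ℕ
  odds = map odd′ (0 ∷ rest)
  bounded-S : All (_≤ m) (0 ∷ rest)
  bounded-S = z≤n ∷ bounded
  evens-even : All (λ z → ∃ λ i → z ≡ 2 * i) (applyUpTo (2 *_) (suc (m + e)))
  evens-even = All.applyUpTo⁺₂ (2 *_) (suc (m + e)) (λ i → i , refl)
  odds-odd : All (λ z → ∃ λ i → z ≡ suc (2 * i)) odds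
  odds-odd = All.map⁺ (All.universal (λ z → m ∸ z , refl) (0 ∷ rest))
  disjoint : ∀ {z} → (∃ λ i → z ≡ 2 * i) → (∃ λ i → z ≡ suc (2 * i)) → ⊥
  disjoint (i , refl) (j , eq) = even≢odd i j eq
  size : suc (m + e + m) ≡ length (1 ∷ replicate (m + e) 2 ++ map (2 *_) D)
  size = cong suc (sym (trans (length-++ (replicate (m + e) 2))
           (cong₂ _+_ (length-replicate (m + e)) (length-map (2 *_) D))))
  low : 2 * (m + e) ≤ suc (m + e + m)
  low = ≤-trans (≤-reflexive (solved m e)) (+-monoˡ-≤ (m + e + m) e≤1)
    where
    solved : ∀ m e → 2 * (m + e) ≡ e + (m + e + m)
    solved = solve-∀
  high : suc (2 * m) ≤ suc (m + e + m)
  high = s≤s (≤-trans (m≤m+n (2 * m) e) (≤-reflexive (solved m e)))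
    where
    solved : ∀ m e → 2 * m + e ≡ m + e + m
    solved = solve-∀
  link : e ≤ 1 → absDiff (2 * (m + e)) (suc (2 * m)) ≡ 1
  link z≤n = trans (cong (λ z → absDiff (2 * z) (suc (2 * m))) (+-identityʳ m)) (absDiff-suc (2 * m))
  link (s≤s z≤n) = trans (cong (λ z → absDiff z (suc (2 * m))) (solved m))
    (trans (absDiff-comm (suc (2 * m)) (2 * m)) (absDiff-suc (2 * m)))
    where
    solved : ∀ m → 2 * (m + 1) ≡ 2 + 2 * m
    solved = solve-∀
  diffs-odds : diffs odds ≡ map (2 *_) (diffs (0 ∷ rest))
  diffs-odds = diffs-map
    (λ {u} {w} u≤m w≤m → trans (absDiff-scale 2 (m ∸ u) (m ∸ w)) (cong (2 *_) (absDiff-reflect u≤m w≤m)))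
    bounded-S

-- Multiplication by `s` modulo `v`

module Scaling (v : ℕ) .{{_ : NonZero v}} (s : ℕ) where

  scale : ℕ → ℕ
  scale u = s * u % v

  scaledLength : ℕ → ℕ
  scaledLength d = scale d ⊓ (v ∸ scale d)

  scale-sum : ∀ u d → scale (u + d) ≡ (scale u + scale d) % v
  scale-sum u d = trans (cong (_% v) (*-distribˡ-+ s u d)) (%-distribˡ-+ (s * u) (s * d) v)

  -- Adding residues either stays below `v` or wraps around once. The absolute difference is
  -- `scale d` in the first case and `v - scale d` in the second, and `edgeLength` does not
  -- distinguish these.
  data Sum (u d : ℕ) : Set where
    below : scale (u + d) ≡ scale u + scale d → Sum u d
    wraps : scale (u + d) + (v ∸ scale d) ≡ scale u → Sum u d

  scale-+ : ∀ u d → Sum u d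
  scale-+ u d with scale u + scale d <? v
  ... | yes A+B<v = below (trans (scale-sum u d) (m<n⇒m%n≡m A+B<v))
  ... | no A+B≮v  = wraps (begin
    scale (u + d) + (v ∸ B) ≡⟨ cong (_+ (v ∸ B)) C≡ ⟩
    C + (v ∸ B)             ≡⟨ +-cancelʳ-≡ B _ _ cancelled ⟩
    A                       ∎)
    where
    open ≡-Reasoning
    A B C : ℕ
    A = scale u
    B = scale d
    C = A + B ∸ v
    B<v : B < v
    B<v = m%n<n (s * d) v
    C+v≡ : C + v ≡ A + B
    C+v≡ = m∸n+n≡m (≮⇒≥ A+B≮v)
    C<v : C < v
    C<v = +-cancelʳ-< v C v (subst (_< v + v) (sym C+v≡) (+-mono-< (m%n<n (s * u) v) B<v))
    C≡ : scale (u + d) ≡ C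
    C≡ = trans (scale-sum u d) (trans (cong (_% v) (sym C+v≡)) (trans ([m+n]%n≡m%n C v) (m<n⇒m%n≡m C<v)))
    cancelled : C + (v ∸ B) + B ≡ A + B
    cancelled = trans (+-assoc C _ B) (trans (cong (C +_) (m∸n+n≡m (<⇒≤ B<v))) C+v≡)

  edgeLength-+ : ∀ u d → edgeLength v (scale u) (scale (u + d)) ≡ scaledLength d
  edgeLength-+ u d with scale-+ u d
  ... | below eq = cong (λ e → e ⊓ (v ∸ e))
    (trans (cong (absDiff (scale u)) eq) (absDiff-+ (scale u) (scale d)))
  ... | wraps eq = begin
    edgeLength v (scale u) (scale (u + d)) ≡⟨ cong (λ e → e ⊓ (v ∸ e)) diff ⟩
    (v ∸ scale d) ⊓ (v ∸ (v ∸ scale d))    ≡⟨ cong ((v ∸ scale d) ⊓_) (m∸[m∸n]≡n (m%n≤n (s * d) v)) ⟩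
    (v ∸ scale d) ⊓ scale d                ≡⟨ ⊓-comm (v ∸ scale d) (scale d) ⟩
    scaledLength d                         ∎
    where
    open ≡-Reasoning
    diff : absDiff (scale u) (scale (u + d)) ≡ v ∸ scale d
    diff = trans (absDiff-comm (scale u) _)
      (trans (cong (absDiff (scale (u + d))) (sym eq)) (absDiff-+ (scale (u + d)) _))

  edgeLength-comm : ∀ u w → edgeLength v u w ≡ edgeLength v w u
  edgeLength-comm u w = cong (λ e → e ⊓ (v ∸ e)) (absDiff-comm u w)

  edgeLength-scale : ∀ u w → edgeLength v (scale u) (scale w) ≡ scaledLength (absDiff u w)
  edgeLength-scale u w with ≤-total u w
  ... | inj₁ u≤w with d , refl ← m≤n⇒∃[o]m+o≡n u≤w =
    trans (edgeLength-+ u d) (cong scaledLength (sym (absDiff-+ u d)))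
  ... | inj₂ w≤u with d , refl ← m≤n⇒∃[o]m+o≡n w≤u =
    trans (edgeLength-comm (scale (w + d)) (scale w))
      (trans (edgeLength-+ w d) (cong scaledLength (sym (trans (absDiff-comm (w + d) w) (absDiff-+ w d)))))

  edgeLengths-scale : ∀ p → edgeLengths v (map scale p) ≡ map scaledLength (diffs p)
  edgeLengths-scale []          = refl
  edgeLengths-scale (u ∷ [])    = refl
  edgeLengths-scale (u ∷ w ∷ p) = cong₂ _∷_ (edgeLength-scale u w) (edgeLengths-scale (w ∷ p))

  -- The alternatives express that `s d` is `-e` or `e` modulo `v`; `e + e ≤ v` makes `e` the
  -- smaller of `e` and `v - e`.
  scaledLength-≡ : ∀ d e m → 0 < e → e + e ≤ v →
                   s * d + e ≡ suc m * v ⊎ s * d ≡ e + m * v → scaledLength d ≡ e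
  scaledLength-≡ d e m 0<e 2e≤v (inj₂ sd≡) =
    trans (cong (λ z → z ⊓ (v ∸ z)) scale≡) (m≤n⇒m⊓n≡m (m+n≤o⇒m≤o∸n e 2e≤v))
    where
    scale≡ : scale d ≡ e
    scale≡ = trans (cong (_% v) sd≡) (trans ([m+kn]%n≡m%n e m v) (m<n⇒m%n≡m (≤-trans (+-monoˡ-≤ e 0<e) 2e≤v)))
  scaledLength-≡ d e m 0<e 2e≤v (inj₁ sd≡) = begin
    scaledLength d              ≡⟨ cong (λ z → z ⊓ (v ∸ z)) scale≡ ⟩
    (v ∸ e) ⊓ (v ∸ (v ∸ e))     ≡⟨ cong ((v ∸ e) ⊓_) (m∸[m∸n]≡n e≤v) ⟩
    (v ∸ e) ⊓ e                 ≡⟨ m≥n⇒m⊓n≡n (m+n≤o⇒m≤o∸n e 2e≤v) ⟩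
    e                           ∎
    where
    open ≡-Reasoning
    e≤v : e ≤ v
    e≤v = ≤-trans (m≤m+n e e) 2e≤v
    rearrange : s * d + e ≡ v ∸ e + m * v + e
    rearrange = begin
      s * d + e             ≡⟨ sd≡ ⟩
      v + m * v             ≡⟨ cong (_+ m * v) (m∸n+n≡m e≤v) ⟨
      v ∸ e + e + m * v     ≡⟨ +-assoc (v ∸ e) e (m * v) ⟩
      v ∸ e + (e + m * v)   ≡⟨ cong (v ∸ e +_) (+-comm e (m * v)) ⟩
      v ∸ e + (m * v + e)   ≡⟨ +-assoc (v ∸ e) (m * v) e ⟨
      v ∸ e + m * v + e     ∎
    scale≡ : scale d ≡ v ∸ e
    scale≡ = begin
      s * d % v             ≡⟨ cong (_% v) (+-cancelʳ-≡ e _ _ rearrange) ⟩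
      (v ∸ e + m * v) % v   ≡⟨ [m+kn]%n≡m%n (v ∸ e) m v ⟩
      (v ∸ e) % v           ≡⟨ m<n⇒m%n≡m (∸-monoʳ-< {v} {e} {0} 0<e e≤v) ⟩
      v ∸ e                 ∎

  module _ (coprime : Coprime v s) where

    scale-injective-+ : ∀ u d → u + d < v → scale u ≡ scale (u + d) → d ≡ 0
    scale-injective-+ u zero    _ _ = refl
    scale-injective-+ u d@(suc _) u+d<v eq with scale-+ u d
    -- Here `v` divides `s d`, hence `d`, which is positive and less than `v`.
    ... | below eq′ = ⊥-elim (>⇒∤ (≤-<-trans (m≤n+m d u) u+d<v)
      (coprime-divisor coprime (m%n≡0⇒n∣m (s * d) v scale≡0)))
      where
      scale≡0 : scale d ≡ 0
      scale≡0 = +-cancelˡ-≡ (scale u) _ _ (trans (sym eq′) (trans (sym eq) (sym (+-identityʳ _))))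
    -- Wrapping around without changing the residue would require `v ≤ scale d`.
    ... | wraps eq′ = ⊥-elim (<⇒≱ (m%n<n (s * d) v)
      (m∸n≡0⇒m≤n (+-cancelˡ-≡ (scale (u + d)) _ _ (trans eq′ (trans eq (sym (+-identityʳ _)))))))

    scale-injective : ∀ {u w} → u < v → w < v → scale u ≡ scale w → u ≡ w
    scale-injective {u} {w} u<v w<v eq with ≤-total u w
    ... | inj₁ u≤w with d , refl ← m≤n⇒∃[o]m+o≡n u≤w =
      sym (trans (cong (u +_) (scale-injective-+ u d w<v eq)) (+-identityʳ u))
    ... | inj₂ w≤u with d , refl ← m≤n⇒∃[o]m+o≡n w≤u =
      trans (cong (w +_) (scale-injective-+ w d u<v (sym eq))) (+-identityʳ w)

    realize : ∀ {D} → suc (length D) ≡ v → Linear D → Realizable v (map scaledLength D)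
    realize {D} v≡ X =
      map scale path
      , (trans (length-map scale path) (trans size v≡)
        , All.map⁺ (All.universal (λ u → m%n<n (s * u) v) path)
        , unique-map scale-injective (All.map (λ u≤ → subst (_ <_) v≡ (s≤s u≤)) bounded) unique)
      , ↭-trans (↭-reflexive (edgeLengths-scale path)) (map⁺ scaledLength steps)
      where open Linear X

-- Paths with three labels

labels₃ : ℕ → ℕ → ℕ → ℕ → ℕ → ℕ → List ℕ
labels₃ x y z a b c = replicate a x ++ replicate b y ++ replicate c z

length-labels₃ : ∀ x y z a b c → length (labels₃ x y z a b c) ≡ a + b + c
length-labels₃ x y z a b c = begin
  length (labels₃ x y z a b c)
    ≡⟨ length-++ (replicate a x) ⟩
  length (replicate a x) + length (replicate b y ++ replicate c z)
    ≡⟨ cong₂ _+_ (length-replicate a) (length-++ (replicate b y)) ⟩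
  a + (length (replicate b y) + length (replicate c z))
    ≡⟨ cong (a +_) (cong₂ _+_ (length-replicate b) (length-replicate c)) ⟩
  a + (b + c)
    ≡⟨ +-assoc a b c ⟨
  a + b + c ∎
  where open ≡-Reasoning

map-labels₃ : ∀ (f : ℕ → ℕ) x y z a b c → map f (labels₃ x y z a b c) ≡ labels₃ (f x) (f y) (f z) a b c
map-labels₃ f x y z a b c = begin
  map f (replicate a x ++ replicate b y ++ replicate c z)
    ≡⟨ map-++ f (replicate a x) _ ⟩
  map f (replicate a x) ++ map f (replicate b y ++ replicate c z)
    ≡⟨ cong₂ _++_ (map-replicate f a x) (map-++ f (replicate b y) _) ⟩
  replicate a (f x) ++ map f (replicate b y) ++ map f (replicate c z)
    ≡⟨ cong (replicate a (f x) ++_) (cong₂ _++_ (map-replicate f b y) (map-replicate f c z)) ⟩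
  labels₃ (f x) (f y) (f z) a b c ∎
  where open ≡-Reasoning

rotate : ∀ x y z a b c → labels₃ x y z a b c ↭ labels₃ y z x b c a
rotate x y z a b c = ↭-trans (++-comm (replicate a x) _) (↭-reflexive (++-assoc (replicate b y) _ _))

-- Of the ones, `x` go into the path for `x`, one is the link, and the remaining `a - x - 1` suffice
-- for the path for `y`.
many-ones : ∀ {x y a} b c → 1 ≤ x → 1 ≤ y → x + y < a → Linear (labels₃ 1 x y a b c)
many-ones {x} {y} {a} b c 1≤x 1≤y x+y<a =
  linear-resp-↭ regroup (join (standard-labels b 1≤x ≤-refl) (standard-labels c 1≤y y≤a′))
  where
  open ≡-Reasoning
  a′ : ℕ
  a′ = a ∸ suc x
  y≤a′ : y ≤ a′
  y≤a′ = m+n≤o⇒m≤o∸n y (≤-trans (≤-reflexive (trans (+-suc y x) (cong suc (+-comm y x)))) x+y<a)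
  ones≡ : 1 ∷ replicate x 1 ++ replicate a′ 1 ≡ replicate a 1
  ones≡ = trans (sym (replicate-+ (suc x) a′ 1))
                (cong (λ n → replicate n 1) (m+[n∸m]≡n (≤-trans (s≤s (m≤m+n x y)) x+y<a)))
  regroup : 1 ∷ labels x x b ++ labels y a′ c ↭ labels₃ 1 x y a b c
  regroup = ↭-trans (↭-reflexive (cong (1 ∷_) (++-assoc (replicate x 1) (replicate b x) _)))
    (↭-trans (++⁺ˡ (replicate (suc x) 1) (shifts (replicate b x) (replicate a′ 1)))
      (↭-reflexive (trans (sym (++-assoc (replicate (suc x) 1) (replicate a′ 1) _))
                          (cong (_++ replicate b x ++ replicate c y) ones≡))))

-- From `d` labels 1 and `a` labels `q`, `rails` makes `2 d + a + e` labels 2 and `a` labels `2 q`;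
-- so `d` and `e` are quotient and remainder of `c - a` by 2, and the bound on `c` gives `q ≤ d`.
-- The link in `rails` consumes one label 1, hence `1 ≤ b`.
many-twos : ∀ {q b c} a → 1 ≤ q → 1 ≤ b → 2 * q + a ≤ c → Linear (labels₃ 1 2 (2 * q) b c a)
many-twos {q} {suc k} {c} a 1≤q _ 2q+a≤c = split (c ∸ a) refl
  where
  c≡ : c ∸ a + a ≡ c
  c≡ = m∸n+n≡m (≤-trans (m≤n+m a (2 * q)) 2q+a≤c)
  2q≤ : q * 2 ≤ c ∸ a
  2q≤ = ≤-trans (≤-reflexive (*-comm q 2)) (m+n≤o⇒m≤o∸n (2 * q) 2q+a≤c)

  assemble : ∀ e d → e ≤ 1 → e + (d * 2 + a) ≡ c → q ≤ d → Linear (labels₃ 1 2 (2 * q) (suc k) c a)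
  assemble e d e≤1 refl q≤d =
    linear-resp-↭ (↭-trans (shift 1 (replicate k 1) _)
                           (↭-reflexive (cong (λ D → 1 ∷ replicate k 1 ++ D) twos≡)))
      (linear (prepend-ones k (rails e e≤1 (standard-labels a 1≤q q≤d))))
    where
    open ≡-Reasoning
    count : ∀ d a e → d + a + e + d ≡ e + (d * 2 + a)
    count = solve-∀
    twos≡ : replicate (length (labels q d a) + e) 2 ++ map (2 *_) (labels q d a)
          ≡ replicate (e + (d * 2 + a)) 2 ++ replicate a (2 * q)
    twos≡ = begin
      replicate (length (labels q d a) + e) 2 ++ map (2 *_) (labels q d a)
        ≡⟨ cong₂ (λ n E → replicate (n + e) 2 ++ E) (length-labels q d a)
             (trans (map-++ (2 *_) (replicate d 1) _)
               (cong₂ _++_ (map-replicate (2 *_) d 1) (map-replicate (2 *_) a q))) ⟩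
      replicate (d + a + e) 2 ++ replicate d 2 ++ replicate a (2 * q)
        ≡⟨ ++-assoc (replicate (d + a + e) 2) _ _ ⟨
      (replicate (d + a + e) 2 ++ replicate d 2) ++ replicate a (2 * q)
        ≡⟨ cong (_++ replicate a (2 * q)) (replicate-+ (d + a + e) d 2) ⟨
      replicate (d + a + e + d) 2 ++ replicate a (2 * q)
        ≡⟨ cong (λ n → replicate n 2 ++ replicate a (2 * q)) (count d a e) ⟩
      replicate (e + (d * 2 + a)) 2 ++ replicate a (2 * q) ∎

  split : ∀ n → n ≡ c ∸ a → Linear (labels₃ 1 2 (2 * q) (suc k) c a)
  split n n≡ with halve n
  ... | even d = assemble 0 d z≤n (trans (cong (_+ a) n≡) c≡)
                   (*-cancelʳ-≤ q d 2 (≤-trans 2q≤ (≤-reflexive (sym n≡))))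
  ... | odd d  = assemble 1 d ≤-refl (trans (cong (_+ a) n≡) c≡)
                   (*-cancelʳ-≤-half (≤-trans 2q≤ (≤-reflexive (sym n≡))))
    where
    *-cancelʳ-≤-half : q * 2 ≤ suc (d * 2) → q ≤ d
    *-cancelʳ-≤-half le = ≤-pred (*-cancelʳ-< 2 q (suc d) (s≤s le))

tally : ∀ {x y z L} → All (λ l → l ≡ x ⊎ l ≡ y ⊎ l ≡ z) L →
        ∃ λ a → ∃ λ b → ∃ λ c → labels₃ x y z a b c ↭ L
tally []                  = 0 , 0 , 0 , ↭-refl
tally {x} {y} {z} (inj₁ refl ∷ ps) with a , b , c , e ← tally ps = suc a , b , c , prep x e
tally {x} {y} {z} (inj₂ (inj₁ refl) ∷ ps) with a , b , c , e ← tally ps =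
  a , suc b , c , ↭-trans (shift y (replicate a x) _) (prep y e)
tally {x} {y} {z} (inj₂ (inj₂ refl) ∷ ps) with a , b , c , e ← tally ps =
  a , b , suc c , ↭-trans (++⁺ˡ (replicate a x) (shift z (replicate b y) _))
                    (↭-trans (shift z (replicate a x) _) (prep z e))

-- The multipliers 1, 3 and `3 t`

-- Only the representatives v − 1 and v + 1 of ±1 modulo v occur here.
infix 4 _≈±1[_]

_≈±1[_] : ℕ → ℕ → Set
m ≈±1[ v ] = suc m ≡ v ⊎ m ≡ suc v

-- A common divisor of `v` and `s` divides both `v` and one of `v ± 1`.
coprime-unit : ∀ {v} s d → s * d ≈±1[ v ] → Coprime v s
coprime-unit s d (inj₁ refl) {k} (k∣v , k∣s) =
  ∣1⇒≡1 (∣m+n∣m⇒∣n (subst (k ∣_) (+-comm 1 (s * d)) k∣v) (∣-trans k∣s (m∣m*n d)))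
coprime-unit {v} s d (inj₂ sd≡) {k} (k∣v , k∣s) =
  ∣1⇒≡1 (∣m+n∣m⇒∣n (subst (k ∣_) (trans sd≡ (+-comm 1 v)) (∣-trans k∣s (m∣m*n d))) k∣v)

realizable-resp-↭ : ∀ {v L M} → L ↭ M → Realizable v L → Realizable v M
realizable-resp-↭ L↭M (p , h , e) = p , h , ↭-trans e L↭M

-- The bound `large` makes 1, 3 and `3 t` at most half of `v`, so that each is its own length modulo
-- `v`.
module Multipliers (t q v : ℕ) (unit : 3 * t * q ≈±1[ v ]) (2≤t : 2 ≤ t)
                   (large : 6 * t + 6 ≤ v) (a b c : ℕ) (size : suc (a + b + c) ≡ v) where

  6≤v : 6 ≤ v
  6≤v = m+n≤o⇒n≤o (6 * t) large

  instance
    v≢0 : NonZero v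
    v≢0 = >-nonZero (≤-trans (s≤s z≤n) 6≤v)

  Goal : Set
  Goal = Realizable v (labels₃ 1 3 (3 * t) a b c)

  3t+3t≤v : 3 * t + 3 * t ≤ v
  3t+3t≤v = ≤-trans (≤-reflexive (sym (*-distribʳ-+ t 3 3))) (m+n≤o⇒m≤o (6 * t) large)
  0<3t : 0 < 3 * t
  0<3t = ≤-trans (≤-trans (n≤1+n 1) 2≤t) (m≤m+n t _)
  2≤v : 2 ≤ v
  2≤v = ≤-trans (s≤s (s≤s z≤n)) 6≤v

  rescale : ∀ s → Coprime v s → ∀ x y z i j k {x′ y′ z′} →
            Scaling.scaledLength v s x ≡ x′ → Scaling.scaledLength v s y ≡ y′ →
            Scaling.scaledLength v s z ≡ z′ →
            labels₃ x′ y′ z′ i j k ↭ labels₃ 1 3 (3 * t) a b c → Linear (labels₃ x y z i j k) → Goal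
  rescale s coprime x y z i j k refl refl refl perm X = realizable-resp-↭ perm
    (subst (Realizable v) (map-labels₃ scaledLength x y z i j k) (realize coprime size′ X))
    where
    open Scaling v s
    size′ : suc (length (labels₃ x y z i j k)) ≡ v
    size′ = trans (cong suc (trans (sym (length-map scaledLength (labels₃ x y z i j k)))
      (trans (cong length (map-labels₃ scaledLength x y z i j k))
        (trans (↭-length perm) (length-labels₃ 1 3 (3 * t) a b c))))) size

  scaled-unit : ∀ s d → s * d ≈±1[ v ] → Scaling.scaledLength v s d ≡ 1
  scaled-unit s d (inj₁ eq) = Scaling.scaledLength-≡ v s d 1 0 ≤-refl 2≤v
    (inj₁ (trans (+-comm (s * d) 1) (trans eq (sym (+-identityʳ v)))))
  scaled-unit s d (inj₂ eq) = Scaling.scaledLength-≡ v s d 1 1 ≤-refl 2≤v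
    (inj₂ (trans eq (cong suc (sym (+-identityʳ v)))))

  scaled-small : ∀ s d {e} → s * d ≡ e → 0 < e → e + e ≤ v → Scaling.scaledLength v s d ≡ e
  scaled-small s d {e} eq 0<e 2e≤v = Scaling.scaledLength-≡ v s d e 0 0<e 2e≤v
    (inj₂ (trans eq (sym (+-identityʳ e))))

  base-1 : Linear (labels₃ 1 3 (3 * t) a b c) → Goal
  base-1 = rescale 1 (Coprimality.sym (Coprimality.1-coprimeTo v)) 1 3 (3 * t) a b c
    (scaled-small 1 1 refl (s≤s z≤n) 2≤v) (scaled-small 1 3 refl (s≤s z≤n) 6≤v)
    (scaled-small 1 (3 * t) (*-identityˡ (3 * t)) 0<3t 3t+3t≤v) ↭-refl

  -- Multiplication by 3 sends 1 to 3, `t` to `3 t` and `t q` to ±1, whence the order `b`, `c`, `a`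
  -- of the multiplicities.
  base-3 : Linear (labels₃ 1 t (t * q) b c a) → Goal
  base-3 = rescale 3 (coprime-unit 3 (t * q) unit′) 1 t (t * q) b c a
    (scaled-small 3 1 refl (s≤s z≤n) 6≤v) (scaled-small 3 t refl 0<3t 3t+3t≤v)
    (scaled-unit 3 (t * q) unit′) (↭-sym (rotate 1 3 (3 * t) a b c))
    where
    unit′ : 3 * (t * q) ≈±1[ v ]
    unit′ = subst (_≈±1[ v ]) (*-assoc 3 t q) unit

  -- Multiplication by `3 t` sends 1 to `3 t`, `q` to ±1 and `3 q` to ±3, whence the order `c`, `a`,
  -- `b`.
  base-3t : Linear (labels₃ 1 q (3 * q) c a b) → Goal
  base-3t = rescale (3 * t) (coprime-unit (3 * t) q unit) 1 q (3 * q) c a b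
    (scaled-small (3 * t) 1 (*-identityʳ (3 * t)) 0<3t 3t+3t≤v)
    (scaled-unit (3 * t) q unit) (thrice unit) (rotate (3 * t) 1 3 c a b)
    where
    thrice : 3 * t * q ≈±1[ v ] → Scaling.scaledLength v (3 * t) (3 * q) ≡ 3
    -- From `3 t q = v - 1` the product is `3 v - 3`; the argument 2 stands for the multiple `3 v`,
    -- because the negative case counts from `suc m`.
    thrice (inj₁ eq) = Scaling.scaledLength-≡ v (3 * t) (3 * q) 3 2 (s≤s z≤n) 6≤v
      (inj₁ (trans (solved t q) (cong (3 *_) eq)))
      where
      solved : ∀ t q → 3 * t * (3 * q) + 3 ≡ 3 * suc (3 * t * q)
      solved = solve-∀
    thrice (inj₂ eq) = Scaling.scaledLength-≡ v (3 * t) (3 * q) 3 3 (s≤s z≤n) 6≤v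
      (inj₂ (trans (solved t q) (trans (cong (3 *_) eq) (solved′ v))))
      where
      solved : ∀ t q → 3 * t * (3 * q) ≡ 3 * (3 * t * q)
      solved = solve-∀
      solved′ : ∀ v → 3 * suc v ≡ 3 + 3 * v
      solved′ = solve-∀

-- Frequency of some label when `v` is large

≤-suc-near : ∀ {m v} → m ≈±1[ v ] → v ≤ suc m
≤-suc-near (inj₁ refl) = ≤-refl
≤-suc-near (inj₂ refl) = ≤-trans (n≤1+n _) (n≤1+n _)

-- A quotient of at most 2 would give `v ≤ 6 t + 1`.
3≤quotient : ∀ {t q v} → 3 * t * q ≈±1[ v ] → 6 * t + 53 < v → 3 ≤ q
3≤quotient {t} {q} {v} unit large = ≮⇒≥ λ q<3 → <⇒≱ large (begin
  v               ≤⟨ ≤-suc-near unit ⟩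
  suc (3 * t * q) ≤⟨ s≤s (*-monoʳ-≤ (3 * t) (≤-pred q<3)) ⟩
  suc (3 * t * 2) ≡⟨ solved t ⟩
  6 * t + 1       ≤⟨ +-monoʳ-≤ (6 * t) (s≤s z≤n) ⟩
  6 * t + 53      ∎)
  where
  open ≤-Reasoning
  solved : ∀ t → suc (3 * t * 2) ≡ 6 * t + 1
  solved = solve-∀

-- With t = 3 + τ, q = 3 + κ and X = κ + τ + τ κ, the two inequalities say
-- 2 X ≤ 9 + δ and 44 + δ ≤ 9 κ + 3 τ + 3 τ κ ≤ 9 X.
clash : ∀ τ κ δ M → let t = 3 + τ ; q = 3 + κ in
        3 * t * q ≤ 3 + 3 * t + (t + t * q) + (q + 3 * q) + δ → 6 * t + 53 + δ ≤ 3 * t * q →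
        9 + δ < 2 * suc M → 9 * M < 44 + δ → ⊥
clash τ κ δ M upper lower 9+δ< 9M< = <⇒≱ 9M< (begin
  44 + δ                    ≤⟨ +-cancelˡ-≤ (27 + 6 * τ) _ _ (subst₂ _≤_ (lower₁ τ δ) (lower₂ τ κ) lower) ⟩
  9 * κ + 3 * τ + 3 * (τ * κ) ≤⟨ m≤m+n _ (6 * τ + 6 * (τ * κ)) ⟩
  9 * κ + 3 * τ + 3 * (τ * κ) + (6 * τ + 6 * (τ * κ)) ≡⟨ total τ κ ⟩
  9 * X                     ≤⟨ *-monoʳ-≤ 9 X≤M ⟩
  9 * M                     ∎)
  where
  open ≤-Reasoning
  X : ℕ
  X = κ + τ + τ * κ
  lower₁ : ∀ τ δ → 6 * (3 + τ) + 53 + δ ≡ 27 + 6 * τ + (44 + δ)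
  lower₁ = solve-∀
  lower₂ : ∀ τ κ → 3 * (3 + τ) * (3 + κ) ≡ 27 + 6 * τ + (9 * κ + 3 * τ + 3 * (τ * κ))
  lower₂ = solve-∀
  upper₁ : ∀ τ κ → 3 * (3 + τ) * (3 + κ) ≡ 27 + 7 * κ + 7 * τ + τ * κ + 2 * (κ + τ + τ * κ)
  upper₁ = solve-∀
  upper₂ : ∀ τ κ δ → 3 + 3 * (3 + τ) + (3 + τ + (3 + τ) * (3 + κ)) + (3 + κ + 3 * (3 + κ)) + δ
                   ≡ 27 + 7 * κ + 7 * τ + τ * κ + (9 + δ)
  upper₂ = solve-∀
  total : ∀ τ κ → 9 * κ + 3 * τ + 3 * (τ * κ) + (6 * τ + 6 * (τ * κ)) ≡ 9 * (κ + τ + τ * κ)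
  total = solve-∀
  X≤M : X ≤ M
  X≤M = ≤-pred (*-cancelˡ-< 2 X (suc M)
    (≤-<-trans (+-cancelˡ-≤ (27 + 7 * κ + 7 * τ + τ * κ) _ _
                 (subst₂ _≤_ (upper₁ τ κ) (upper₂ τ κ δ) upper)) 9+δ<))

-- The three bounds add up to `t q` plus linear terms, whereas the number of labels is about
-- `3 t q`; `clash` makes this precise.
some-label-frequent : ∀ t q v a b c → 3 ≤ t → 3 * t * q ≈±1[ v ] → 6 * t + 53 < v → suc (a + b + c) ≡ v →
                      a ≤ 3 + 3 * t → b ≤ t + t * q → c ≤ q + 3 * q → ⊥
some-label-frequent t q v a b c 3≤t unit large size a≤ b≤ c≤
  with τ , refl ← m≤n⇒∃[o]m+o≡n 3≤t | κ , refl ← m≤n⇒∃[o]m+o≡n (3≤quotient {t} unit large) = contra unit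
  where
  total : a + b + c ≤ 3 + 3 * t + (t + t * q) + (q + 3 * q)
  total = +-mono-≤ (+-mono-≤ a≤ b≤) c≤
  contra : 3 * t * q ≈±1[ v ] → ⊥
  -- The argument `δ` is `3 t q` minus the number of labels, here 0, and `M` is the largest number
  -- with `2 M ≤ 9 + δ`, here 4.
  contra (inj₁ eq) = clash τ κ 0 4
    (≤-trans (≤-reflexive (suc-injective (trans eq (sym size)))) (≤-trans total (m≤m+n _ 0)))
    (≤-trans (≤-reflexive (+-identityʳ _)) (≤-pred (≤-trans large (≤-reflexive (sym eq)))))
    (from-yes (10 ≤? 10)) (from-yes (37 ≤? 44))
  -- Now `9 * 5 < 44 + 2` holds with nothing to spare: this case takes the full strength of the
  -- constant 53.
  contra (inj₂ eq) = clash τ κ 2 5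
    (≤-trans (≤-reflexive (trans eq (trans (cong suc (sym size)) (+-comm 2 (a + b + c)))))
             (+-monoˡ-≤ 2 total))
    (≤-trans (≤-reflexive (+-comm _ 2)) (≤-trans (s≤s large) (≤-reflexive (sym eq))))
    (from-yes (12 ≤? 12)) (from-yes (46 ≤? 46))

-- For `t = 2` the bound on `c` negates the condition of `many-twos`. Together the bounds give
-- `v ≤ 4 q + 20`, while `v ≥ 6 q - 1`; hence `q ≤ 10` and `v ≤ 61`.
some-label-frequent-2 : ∀ q v a b c → 3 * 2 * q ≈±1[ v ] → 65 < v → suc (a + b + c) ≡ v →
                        a ≤ 9 → b ≤ 2 + 2 * q → c < 2 * q + a → ⊥
some-label-frequent-2 q v a b c unit large size a≤ b≤ c< = contra unit
  where
  open ≤-Reasoning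
  solved : ∀ q → 9 + (2 + 2 * q) + (2 * q + 9) ≡ 20 + 4 * q
  solved = solve-∀
  v≤ : v ≤ 20 + 4 * q
  v≤ = begin
    v                               ≡⟨ size ⟨
    suc (a + b + c)                 ≡⟨ +-suc (a + b) c ⟨
    a + b + suc c                   ≤⟨ +-mono-≤ (+-mono-≤ a≤ b≤) (≤-trans c< (+-monoʳ-≤ (2 * q) a≤)) ⟩
    9 + (2 + 2 * q) + (2 * q + 9)   ≡⟨ solved q ⟩
    20 + 4 * q                      ∎
  q≤10 : ∀ {d} → d ≤ 21 → 6 * q ≤ d + 4 * q → q ≤ 10
  q≤10 {d} d≤ le = ≤-pred (*-cancelˡ-< 2 q 11
    (s≤s (≤-trans (+-cancelʳ-≤ (4 * q) _ _ (≤-trans (≤-reflexive (split q)) le)) d≤)))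
    where
    split : ∀ q → 2 * q + 4 * q ≡ 6 * q
    split = solve-∀
  contra : 3 * 2 * q ≈±1[ v ] → ⊥
  contra near = <⇒≱ large (≤-trans (≤-suc-near near)
    (≤-trans (s≤s (*-monoʳ-≤ 6 (q≤10 ≤-refl (6q≤ near)))) (from-yes (61 ≤? 65))))
    where
    6q≤ : 3 * 2 * q ≈±1[ v ] → 6 * q ≤ 21 + 4 * q
    6q≤ (inj₁ eq) = ≤-trans (n≤1+n _) (≤-trans (≤-reflexive eq) (≤-trans v≤ (n≤1+n _)))
    6q≤ (inj₂ eq) = ≤-trans (≤-reflexive eq) (s≤s v≤)

-- Choice of the multiplier

multiplicity≥1 : ∀ {x y z b} a c → y ≢ x → y ≢ z → y ∈ labels₃ x y z a b c → 1 ≤ b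
multiplicity≥1 {b = suc b} a c _ _ _ = s≤s z≤n
multiplicity≥1 {x} {y} {z} {zero} a c y≢x y≢z y∈ =
  ⊥-elim (All.lookup (All.++⁺ (All.replicate⁺ a y≢x) (All.replicate⁺ c y≢z)) y∈ refl)

realizable : ∀ t q v a b c → 2 ≤ t → 3 * t * q ≈±1[ v ] → 6 * t + 53 < v → suc (a + b + c) ≡ v → 1 ≤ b →
             Realizable v (labels₃ 1 3 (3 * t) a b c)
realizable t q v a b c 2≤t unit large size 1≤b = select (3 + 3 * t <? a) (t + t * q <? b) (m≤n⇒m<n∨m≡n 2≤t)
  where
  6t+6≤v : 6 * t + 6 ≤ v
  6t+6≤v = ≤-trans (+-monoʳ-≤ (6 * t) (m≤m+n 6 47)) (<⇒≤ large)
  open Multipliers t q v unit 2≤t 6t+6≤v a b c size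
  1≤t : 1 ≤ t
  1≤t = ≤-trans (n≤1+n 1) 2≤t
  1≤q : 1 ≤ q
  1≤q = ≤-trans (s≤s z≤n) (3≤quotient {t} unit large)
  select : Dec (3 + 3 * t < a) → Dec (t + t * q < b) → 2 < t ⊎ 2 ≡ t → Goal
  select (yes A) _ _ = base-1 (many-ones b c (s≤s z≤n) 0<3t A)
  select (no _) (yes B) _ = base-3 (many-ones c a 1≤t (*-mono-≤ 1≤t 1≤q) B)
  select (no ¬A) (no ¬B) (inj₁ 3≤t) with q + 3 * q <? c
  ... | yes C = base-3t (many-ones a b 1≤q (≤-trans 1≤q (m≤m+n q _)) C)
  ... | no ¬C = ⊥-elim (some-label-frequent t q v a b c 3≤t unit large size (≮⇒≥ ¬A) (≮⇒≥ ¬B) (≮⇒≥ ¬C))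
  select (no ¬A) (no ¬B) (inj₂ refl) with 2 * q + a ≤? c
  -- The multiplier 3 turns labels 1 into labels 3, so `1≤b` provides the link between the even and
  -- the odd vertices.
  ... | yes C = base-3 (many-twos a 1≤q 1≤b C)
  ... | no ¬C = ⊥-elim (some-label-frequent-2 q v a b c unit large size (≮⇒≥ ¬A) (≮⇒≥ ¬B) (≰⇒> ¬C))

divisible⇒unit : ∀ v m → 1 ≤ v → (m ∣ v ∸ 1) ⊎ (m ∣ v + 1) → ∃ λ q → m * q ≈±1[ v ]
divisible⇒unit (suc n) m _ (inj₁ (divides q eq)) = q , inj₁ (cong suc (trans (*-comm m q) (sym eq)))
divisible⇒unit (suc n) m _ (inj₂ (divides q eq)) =
  q , inj₂ (trans (*-comm m q) (trans (sym eq) (cong suc (+-comm n 1))))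

theorem5p2 : (t v : ℕ) → 2 ≤ t → 1 ≤ v
    → ((3 * t ∣ v ∸ 1) ⊎ (3 * t ∣ v + 1))
    → 6 * t + 53 < v
    → (L : List ℕ) → length L ≡ v ∸ 1 → HasSupport3 L 1 3 (3 * t)
    → Realizable v L
theorem5p2 t v 2≤t 1≤v near large L size (labelled , _ , 3∈L , _)
  with a , b , c , perm ← tally labelled | q , unit ← divisible⇒unit v (3 * t) 1≤v near
  = realizable-resp-↭ perm (realizable t q v a b c 2≤t unit large size′
      (multiplicity≥1 a c (λ ()) 3≢3t (∈-resp-↭ (↭-sym perm) 3∈L)))
  where
  size′ : suc (a + b + c) ≡ v
  size′ = trans (cong suc (trans (sym (length-labels₃ 1 3 (3 * t) a b c)) (trans (↭-length perm) size)))
                (m+[n∸m]≡n 1≤v)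
  3≢3t : 3 ≢ 3 * t
  3≢3t eq = <⇒≢ 2≤t (*-cancelˡ-≡ 1 t 3 eq)
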